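{- Let $m\in\mathbb{N}$ be odd and write $m=2k+1$. Let $\varepsilon=1$ if $k$ is even and $3\nmid k$, and $\varepsilon=0$ otherwise. Then the friendship graph $F_j$ is $\mathbb{Z}_m$-cordial for every integer $j$ with $\lfloor m/2\rfloor\le j\le\lfloor 2m/3\rfloor-\varepsilon$.
   Context: Graphs are finite, simple and undirected. For $n\in\mathbb{N}$, the friendship graph $F_n$ is the union of $n$ copies of the triangle $C_3$ joined at a single common (central) vertex. For an abelian group $A$ and a graph $G=(V,E)$, a vertex labeling $\ell:V\to A$ induces an edge labeling $\ell(\{v_1,v_2\})=\ell(v_1)+\ell(v_2)$. Let $f_V(a)=|\{v\in V:\ell(v)=a\}|$ and $f_E(a)=|\{e\in E:\ell(e)=a\}|$. The labeling is $A$-cordial if $|f_V(a_1)-f_V(a_2)|\le 1$ and $|f_E(a_1)-f_E(a_2)|\le 1$ for all $a_1,a_2\in A$; $G$ is $A$-cordial if it admits an $A$-cordial labeling. -}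

module Defs where

open import Algebra.Bundles using (AbelianGroup)
open import Data.Bool using (if_then_else_)
open import Data.Fin as Fin using (Fin; zero; suc; toℕ; quotient)
import Data.Fin.Properties as Fin
open import Data.List using (List; length; filter; allFin; cartesianProduct)
open import Data.Nat
open import Data.Nat.Divisibility using (_∣_; _∣?_)
open import Data.Nat.DivMod
open import Data.Nat.Properties
open import Data.Product using (_×_; _,_; ∃-syntax)
open import Data.Unit using (⊤; tt)
open import Function using (_∘_)
open import Level using (0ℓ)
open import Relation.Binary
  using (Rel; Decidable; Irreflexive; Symmetric)
open import Relation.Binary.PropositionalEquality
open import Relation.Nullary using (yes; ¬?; _×-dec_; does)
import Relation.Unary as U

record Graph : Set₁ where
  field
    order      : ℕ
    Adj        : Rel (Fin order) 0ℓ
    adj?       : Decidable Adj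
    adj-sym    : Symmetric Adj
    adj-irrefl : Irreflexive _≡_ Adj

  Vertex : Set
  Vertex = Fin order

  vertices : List Vertex
  vertices = allFin order

  -- The edge {u , v} is listed once, as the pair (u , v) with u < v.
  edges : List (Vertex × Vertex)
  edges = filter (λ (u , v) → (u Fin.<? v) ×-dec adj? u v)
                 (cartesianProduct vertices vertices)

-- Decidable equality of the group is needed in order to count labels.
module _ {c ℓ} (A : AbelianGroup c ℓ)
         (_≟A_ : Decidable (AbelianGroup._≈_ A)) (G : Graph) where
  open AbelianGroup A using (Carrier; _∙_)
  open Graph G using (Vertex; vertices; edges)

  edgeLabel : (Vertex → Carrier) → Vertex × Vertex → Carrier
  edgeLabel lab (u , v) = lab u ∙ lab v

  f-V : (Vertex → Carrier) → Carrier → ℕ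
  f-V lab a = length (filter (λ v → lab v ≟A a) vertices)

  f-E : (Vertex → Carrier) → Carrier → ℕ
  f-E lab a = length (filter (λ e → edgeLabel lab e ≟A a) edges)

  IsCordialLabeling : (Vertex → Carrier) → Set c
  IsCordialLabeling lab = ∀ a₁ a₂ →
    ∣ f-V lab a₁ - f-V lab a₂ ∣ ≤ 1 × ∣ f-E lab a₁ - f-E lab a₂ ∣ ≤ 1

  Cordial : Set c
  Cordial = ∃[ lab ] IsCordialLabeling lab

-- Vertex zero is the centre; vertex suc x is a non-central vertex of the
-- triangle numbered quotient 2 x, so each triangle has two of these.
module _ {n : ℕ} where
  OnTriangle : Fin n → Fin (suc (n * 2)) → Set
  OnTriangle i zero    = ⊤
  OnTriangle i (suc x) = quotient 2 x ≡ i

  onTriangle? : ∀ i → U.Decidable (OnTriangle i)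
  onTriangle? i zero    = yes tt
  onTriangle? i (suc x) = quotient 2 x Fin.≟ i

F : ℕ → Graph
F n = record
  { order      = suc (n * 2)
  ; Adj        = λ u v → u ≢ v × ∃[ i ] (OnTriangle {n} i u × OnTriangle i v)
  ; adj?       = λ u v → ¬? (u Fin.≟ v) ×-dec
                         Fin.any? (λ i → onTriangle? i u ×-dec onTriangle? i v)
  ; adj-sym    = λ (u≢v , i , p , q) → u≢v ∘ sym , i , q , p
  ; adj-irrefl = λ u≡v (u≢v , _) → u≢v u≡v
  }

module _ (m : ℕ) .{{_ : NonZero m}} where

  private
    _⊕_ : Fin m → Fin m → Fin m
    a ⊕ b = (toℕ a + toℕ b) mod m

    ⊖_ : Fin m → Fin m
    ⊖ a = (m ∸ toℕ a) mod m

    toℕ-mod : ∀ x → toℕ (x mod m) ≡ x % m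
    toℕ-mod x = Fin.toℕ-fromℕ< (m%n<n x m)

    mod-cong : ∀ {x y} → x % m ≡ y % m → x mod m ≡ y mod m
    mod-cong {x} {y} eq = Fin.toℕ-injective
      (trans (toℕ-mod x) (trans eq (sym (toℕ-mod y))))

    toℕ-% : ∀ (a : Fin m) → toℕ a % m ≡ toℕ a
    toℕ-% a = m<n⇒m%n≡m (Fin.toℕ<n a)

    mod-toℕ : ∀ (a : Fin m) → toℕ a mod m ≡ a
    mod-toℕ a = Fin.toℕ-injective (trans (toℕ-mod (toℕ a)) (toℕ-% a))

    %-absorbˡ : ∀ x y → (x % m + y) % m ≡ (x + y) % m
    %-absorbˡ x y = begin
      (x % m + y) % m          ≡⟨ %-distribˡ-+ (x % m) y m ⟩
      (x % m % m + y % m) % m  ≡⟨ cong (λ z → (z + y % m) % m) (m%n%n≡m%n x m) ⟩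
      (x % m + y % m) % m      ≡⟨ %-distribˡ-+ x y m ⟨
      (x + y) % m              ∎
      where open ≡-Reasoning

    ⊕-modˡ : ∀ x b → (x mod m) ⊕ b ≡ (x + toℕ b) mod m
    ⊕-modˡ x b = mod-cong
      (trans (cong (λ z → (z + toℕ b) % m) (toℕ-mod x)) (%-absorbˡ x (toℕ b)))

    ⊕-comm : ∀ a b → a ⊕ b ≡ b ⊕ a
    ⊕-comm a b = cong (λ z → z mod m) (+-comm (toℕ a) (toℕ b))

    ⊕-assoc : ∀ a b c → (a ⊕ b) ⊕ c ≡ a ⊕ (b ⊕ c)
    ⊕-assoc a b c = begin
      (a ⊕ b) ⊕ c                      ≡⟨ ⊕-modˡ (toℕ a + toℕ b) c ⟩
      (toℕ a + toℕ b + toℕ c) mod m    ≡⟨ cong (λ z → z mod m) (+-assoc (toℕ a) _ _) ⟩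
      (toℕ a + (toℕ b + toℕ c)) mod m  ≡⟨ cong (λ z → z mod m) (+-comm (toℕ a) _) ⟩
      (toℕ b + toℕ c + toℕ a) mod m    ≡⟨ ⊕-modˡ (toℕ b + toℕ c) a ⟨
      (b ⊕ c) ⊕ a                      ≡⟨ ⊕-comm (b ⊕ c) a ⟩
      a ⊕ (b ⊕ c)                      ∎
      where open ≡-Reasoning

    ⊕-identityˡ : ∀ a → (0 mod m) ⊕ a ≡ a
    ⊕-identityˡ a = trans (⊕-modˡ 0 a) (mod-toℕ a)

    ⊕-inverseˡ : ∀ a → (⊖ a) ⊕ a ≡ 0 mod m
    ⊕-inverseˡ a = begin
      (⊖ a) ⊕ a                      ≡⟨ ⊕-modˡ (m ∸ toℕ a) a ⟩
      (m ∸ toℕ a + toℕ a) mod m      ≡⟨ cong (λ z → z mod m) (m∸n+n≡m (<⇒≤ (Fin.toℕ<n a))) ⟩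
      m mod m                        ≡⟨ mod-cong (trans (n%n≡0 m) (sym (m*n%n≡0 0 m))) ⟩
      0 mod m                        ∎
      where open ≡-Reasoning

  ℤ/ : AbelianGroup 0ℓ 0ℓ
  ℤ/ = record
    { Carrier = Fin m
    ; _≈_     = _≡_
    ; _∙_     = _⊕_
    ; ε       = 0 mod m
    ; _⁻¹     = ⊖_
    ; isAbelianGroup = record
      { isGroup = record
        { isMonoid = record
          { isSemigroup = record
            { isMagma = record
              { isEquivalence = isEquivalence
              ; ∙-cong = cong₂ _⊕_ }
            ; assoc = ⊕-assoc }
          ; identity = ⊕-identityˡ , λ a → trans (⊕-comm a _) (⊕-identityˡ a) }
        ; inverse = ⊕-inverseˡ , λ a → trans (⊕-comm a _) (⊕-inverseˡ a)
        ; ⁻¹-cong = cong ⊖_ }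
      ; comm = ⊕-comm }
    }

-- Since 3 ∣ 0, ε 0 is 0; ε k is 1 only if k ≥ 2, so subtracting it from
-- (2 * (2 * k + 1)) / 3 never truncates.
ε : ℕ → ℕ
ε k = if does ((2 ∣? k) ×-dec ¬? (3 ∣? k)) then 1 else 0

{-# OPTIONS --safe #-}
-- Label the centre 0. If m = 2u + d + 1, let every nonzero residue label an outer vertex
-- once, and let the middle block D = [u + 1, u + d] label a second time. Then a vertex
-- label a occurs 1 + [a ∈ D] times, and the edges at the centre carry exactly the outer
-- labels. So it suffices to pair the outer labels into triangles in such a way that one
-- pair sums to 0 (which makes up for the missing outer label 0), and that the sums of the
-- other pairs are distinct modulo m and avoid D. The blocks [1, u] and [u + d + 1, 2u + d]
-- are paired in parallel; their sums progress in steps of 2. The two copies of D are paired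
-- in parallel too, x with x for odd u and x with x + 1 for even u, so that their sums fall
-- into the gaps of the first progression. For odd u the middle pair of the outer blocks sums
-- to m; for even u it is the pair of the two ends of D, left over by the shift.
module Submission where

open import Defs
open import Algebra.Bundles using (AbelianGroup)
open import Data.Empty using (⊥)
open import Data.Fin as Fin using (Fin; zero; suc; toℕ; combine; quotient; remQuot; _≟_)
import Data.Fin.Properties as Fin
open import Data.List
  using (List; []; _∷_; [_]; _++_; map; length; filter; allFin; lookup; tabulate; cartesianProduct)
open import Data.List.Membership.Propositional using (_∈_)
open import Data.List.Membership.Propositional.Properties
open import Data.List.Membership.Propositional.Properties.WithK using (unique∧set⇒bag)
open import Data.List.Properties
  using (filter-++; length-++; map-++; map-tabulate; tabulate-cong;
         tabulate-lookup; ++-assoc; ++-identityʳ)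
open import Data.List.Relation.Binary.BagAndSetEquality using (∼bag⇒↭)
open import Data.List.Relation.Binary.Permutation.Propositional
  using (_↭_; ↭-reflexive; ↭-trans; ↭-prep; module PermutationReasoning)
open import Data.List.Relation.Binary.Permutation.Propositional.Properties
  using (↭-length; filter-↭; shift; ++⁺ˡ; ++⁺ʳ; ++-comm; ++-commutativeMonoid)
open import Data.List.Relation.Unary.Any using (here)
open import Data.List.Relation.Unary.All using ([])
open import Data.List.Relation.Unary.Unique.Propositional using (Unique; []; _∷_)
import Data.List.Relation.Unary.Unique.Propositional.Properties as Unique
open import Data.Nat using (ℕ; NonZero; zero; suc; _+_; _*_; _∸_; _≤_; _<_; z≤n; s≤s; ∣_-_∣; _%_)
open import Data.Nat.DivMod
open import Data.Nat.Properties hiding (_≟_)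
open import Data.Nat.Tactic.RingSolver using (solve-∀)
open import Data.Product using (_×_; _,_; proj₁; proj₂; ∃-syntax; uncurry)
open import Data.Sum using (_⊎_; inj₁; inj₂)
open import Function using (_∘_; id; mk⇔)
open import Relation.Binary.PropositionalEquality hiding ([_])
open import Relation.Nullary using (yes; no; contradiction; _×-dec_)
import Algebra.Solver.CommutativeMonoid as CommutativeMonoidSolver

open CommutativeMonoidSolver (++-commutativeMonoid {A = ℕ}) using (solve; _⊜_; _⊕_)

-- Vertices and edges of the friendship graph, up to permutation.

module _ {a} {A : Set a} where

  -- Reduces each enumeration below to a membership check in both directions, since bag equality and
  -- set equality agree on duplicate-free lists.
  unique∧set⇒↭ : {xs ys : List A} → Unique xs → Unique ys →
                 (∀ {x} → x ∈ xs → x ∈ ys) → (∀ {x} → x ∈ ys → x ∈ xs) → xs ↭ ys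
  unique∧set⇒↭ xs! ys! to from = ∼bag⇒↭ (unique∧set⇒bag xs! ys! (mk⇔ to from))

module Friendship (n : ℕ) where

  leaf₀ leaf₁ : Fin n → Fin (n * 2)
  leaf₀ i = combine i zero
  leaf₁ i = combine i (suc zero)

  spoke : Fin (n * 2) → Fin (suc (n * 2)) × Fin (suc (n * 2))
  spoke x = zero , suc x

  rim : Fin n → Fin (suc (n * 2)) × Fin (suc (n * 2))
  rim i = suc (leaf₀ i) , suc (leaf₁ i)

  leaf₀<leaf₁ : ∀ i → leaf₀ i Fin.< leaf₁ i
  leaf₀<leaf₁ i rewrite Fin.toℕ-combine i (zero {1}) | Fin.toℕ-combine i (suc (zero {0})) =
    +-monoʳ-< (2 * toℕ i) (s≤s z≤n)

  leaves-↭ : allFin (n * 2) ↭ map leaf₀ (allFin n) ++ map leaf₁ (allFin n)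
  leaves-↭ = unique∧set⇒↭ (Unique.allFin⁺ _)
    (Unique.++⁺ (Unique.map⁺ (Fin.combine-injectiveˡ _ _ _ _) (Unique.allFin⁺ n))
                (Unique.map⁺ (Fin.combine-injectiveˡ _ _ _ _) (Unique.allFin⁺ n))
                disjoint)
    (λ {x} _ → to x) (λ _ → ∈-allFin _)
    where
    disjoint : ∀ {x} → x ∈ map leaf₀ (allFin n) × x ∈ map leaf₁ (allFin n) → ⊥
    disjoint (p , q) with i , _ , refl ← ∈-map⁻ leaf₀ p | i′ , _ , eq ← ∈-map⁻ leaf₁ q
      with () ← Fin.combine-injectiveʳ i zero i′ (suc zero) eq
    to : ∀ x → x ∈ map leaf₀ (allFin n) ++ map leaf₁ (allFin n)
    to x with Fin.combine-surjective {n} {2} x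
    ... | i , zero     , refl = ∈-++⁺ˡ (∈-map⁺ leaf₀ (∈-allFin i))
    ... | i , suc zero , refl = ∈-++⁺ʳ _ (∈-map⁺ leaf₁ (∈-allFin i))

  -- As edges are listed with the smaller end first, an edge at the centre begins with `zero` and is
  -- a spoke. Any other edge joins the two leaves of one triangle.
  edges-↭ : Graph.edges (F n) ↭ map spoke (allFin (n * 2)) ++ map rim (allFin n)
  edges-↭ = unique∧set⇒↭
    (Unique.filter⁺ edge? (Unique.cartesianProduct⁺ (Unique.allFin⁺ _) (Unique.allFin⁺ _)))
    (Unique.++⁺ (Unique.map⁺ (Fin.suc-injective ∘ cong proj₂) (Unique.allFin⁺ _))
                (Unique.map⁺ (Fin.combine-injectiveˡ _ _ _ _ ∘ Fin.suc-injective ∘ cong proj₁)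
                             (Unique.allFin⁺ n))
                disjoint)
    (λ p → let _ , u<v , _ , adj = ∈-filter⁻ edge? {xs = pairs} p in to u<v adj)
    from
    where
    open Graph (F n) using (vertices; Adj; adj?)
    pairs : List (Fin (suc (n * 2)) × Fin (suc (n * 2)))
    pairs = cartesianProduct vertices vertices
    edge? = λ ((u , v) : Fin (suc (n * 2)) × Fin (suc (n * 2))) → (u Fin.<? v) ×-dec adj? u v
    disjoint : ∀ {e} → e ∈ map spoke (allFin (n * 2)) × e ∈ map rim (allFin n) → ⊥
    disjoint (p , q) with _ , _ , refl ← ∈-map⁻ spoke p with _ , _ , () ← ∈-map⁻ rim q
    quotient-combine : ∀ (i : Fin n) a → quotient 2 (combine i a) ≡ i
    quotient-combine i a = cong proj₁ (Fin.remQuot-combine i a)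
    to : ∀ {u v} → u Fin.< v → ∃[ i ] (OnTriangle {n} i u × OnTriangle i v) →
         (u , v) ∈ map spoke (allFin (n * 2)) ++ map rim (allFin n)
    to {zero}  {suc y} _   _ = ∈-++⁺ˡ (∈-map⁺ spoke (∈-allFin y))
    -- Both ends lie on the same triangle, which identifies `i′` with `i`. The order then excludes
    -- every choice but `leaf₀` before `leaf₁`.
    to {suc x} {suc y} x<y (_ , refl , q)
      with Fin.combine-surjective {n} {2} x | Fin.combine-surjective {n} {2} y
    ... | i , a , refl | i′ , b , refl
      with refl ← trans (sym (quotient-combine i′ b)) (trans q (quotient-combine i a))
      with a | b
    ... | zero     | suc zero = ∈-++⁺ʳ _ (∈-map⁺ rim (∈-allFin i))
    ... | zero     | zero     = contradiction x<y (<-irrefl refl)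
    ... | suc zero | suc zero = contradiction x<y (<-irrefl refl)
    ... | suc zero | zero     =
      contradiction x<y (<-asym (s≤s (leaf₀<leaf₁ i)))
    from : ∀ {e} → e ∈ map spoke (allFin (n * 2)) ++ map rim (allFin n) → e ∈ filter edge? pairs
    from p with ∈-++⁻ (map spoke (allFin (n * 2))) p
    ... | inj₁ p with x , _ , refl ← ∈-map⁻ spoke p =
      ∈-filter⁺ edge? (∈-cartesianProduct⁺ (∈-allFin _) (∈-allFin _))
        (s≤s z≤n , (λ ()) , quotient 2 x , _ , refl)
    ... | inj₂ p with i , _ , refl ← ∈-map⁻ rim p =
      ∈-filter⁺ edge? (∈-cartesianProduct⁺ (∈-allFin _) (∈-allFin _))
        ( s≤s (leaf₀<leaf₁ i)
        , (λ eq → <-irrefl (cong toℕ (Fin.suc-injective eq)) (leaf₀<leaf₁ i))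
        , i , quotient-combine i zero , quotient-combine i (suc zero))

-- Counting the elements with a given label.

opaque

  -- Opaque, so that later goals keep this form instead of unfolding into filters; they are
  -- transformed by the laws that follow.
  occ : ∀ {m} {A : Set} → (A → Fin m) → Fin m → List A → ℕ
  occ f a xs = length (filter (λ x → f x ≟ a) xs)

module _ {m : ℕ} {A : Set} where

  opaque
    unfolding occ

    occ-filter : ∀ (f : A → Fin m) a xs → length (filter (λ x → f x ≟ a) xs) ≡ occ f a xs
    occ-filter f a xs = refl

    occ-++ : ∀ (f : A → Fin m) a xs ys → occ f a (xs ++ ys) ≡ occ f a xs + occ f a ys
    occ-++ f a xs ys = trans (cong length (filter-++ (λ x → f x ≟ a) xs ys))
                             (length-++ (filter (λ x → f x ≟ a) xs))

    occ-↭ : ∀ (f : A → Fin m) a {xs ys} → xs ↭ ys → occ f a xs ≡ occ f a ys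
    occ-↭ f a = ↭-length ∘ filter-↭ (λ x → f x ≟ a)

    occ-cong : ∀ {f g : A → Fin m} a → f ≗ g → ∀ xs → occ f a xs ≡ occ g a xs
    occ-cong a f≗g []       = refl
    occ-cong {g = g} a f≗g (x ∷ xs) rewrite f≗g x with g x ≟ a
    ... | yes _ = cong suc (occ-cong a f≗g xs)
    ... | no  _ = occ-cong a f≗g xs

    occ-map : ∀ {B : Set} (f : A → Fin m) (g : B → A) a xs → occ f a (map g xs) ≡ occ (f ∘ g) a xs
    occ-map f g a []       = refl
    occ-map f g a (x ∷ xs) with f (g x) ≟ a
    ... | yes _ = cong suc (occ-map f g a xs)
    ... | no  _ = occ-map f g a xs

  -- Passes from counting over triangles, numbered by positions, to counting over the list of their
  -- label pairs.
  occ-lookup : ∀ (f : A → Fin m) a xs → occ (f ∘ lookup xs) a (allFin (length xs)) ≡ occ f a xs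
  occ-lookup f a xs = begin
    occ (f ∘ lookup xs) a (allFin _)      ≡⟨ occ-map f (lookup xs) a (allFin _) ⟨
    occ f a (map (lookup xs) (allFin _))  ≡⟨ cong (occ f a) (map-tabulate id (lookup xs)) ⟩
    occ f a (tabulate (lookup xs))        ≡⟨ cong (occ f a) (tabulate-lookup xs) ⟩
    occ f a xs                            ∎
    where open ≡-Reasoning

opaque
  unfolding occ

  occ-allFin : ∀ {m} (a : Fin m) → occ id a (allFin m) ≡ 1
  occ-allFin {m} a = ↭-length (unique∧set⇒↭ {ys = [ a ]}
    (Unique.filter⁺ (_≟ a) (Unique.allFin⁺ m)) ([] ∷ [])
    (λ p → here (proj₂ (∈-filter⁻ (_≟ a) {xs = allFin m} p)))
    (λ { (here refl) → ∈-filter⁺ (_≟ a) (∈-allFin a) refl }))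

-- Intervals, progressions with step 2, and parallel pairings.

interval : ℕ → ℕ → List ℕ
interval s zero    = []
interval s (suc n) = s ∷ interval (suc s) n

step₂ : ℕ → ℕ → List ℕ
step₂ s zero    = []
step₂ s (suc n) = s ∷ step₂ (2 + s) n

parallel : ℕ → ℕ → ℕ → List (ℕ × ℕ)
parallel x y zero    = []
parallel x y (suc n) = (x , y) ∷ parallel (suc x) (suc y) n

-- The second start is given by an equation, so that it can be written in whatever form the caller's
-- goal has.
interval-++ : ∀ s p {n s′} → s + p ≡ s′ → interval s (p + n) ≡ interval s p ++ interval s′ n
interval-++ s zero    eq = cong (λ z → interval z _) (trans (sym (+-identityʳ s)) eq)
interval-++ s (suc p) eq = cong (s ∷_) (interval-++ (suc s) p (trans (sym (+-suc s p)) eq))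

step₂-++ : ∀ s p {n s′} → s + (p + p) ≡ s′ → step₂ s (p + n) ≡ step₂ s p ++ step₂ s′ n
step₂-++ s zero    eq = cong (λ z → step₂ z _) (trans (sym (+-identityʳ s)) eq)
step₂-++ s (suc p) eq = cong (s ∷_) (step₂-++ (2 + s) p (trans (lemma s p) eq))
  where
  lemma : ∀ s p → 2 + s + (p + p) ≡ s + (suc p + suc p)
  lemma = solve-∀

step₂-interleave : ∀ s n → step₂ s n ++ step₂ (suc s) n ↭ interval s (n + n)
step₂-interleave s zero    = ↭-reflexive refl
step₂-interleave s (suc n) = begin
  s ∷ (step₂ (2 + s) n ++ suc s ∷ step₂ (3 + s) n)  ↭⟨ ↭-prep s (shift (suc s) (step₂ (2 + s) n) _) ⟩
  s ∷ suc s ∷ (step₂ (2 + s) n ++ step₂ (3 + s) n)  ↭⟨ ↭-prep s (↭-prep (suc s) (step₂-interleave (2 + s) n)) ⟩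
  interval s (2 + (n + n))                          ≡⟨ cong (interval s ∘ suc) (sym (+-suc n n)) ⟩
  interval s (suc n + suc n)                        ∎
  where open PermutationReasoning

-- Once `s` is removed, the two progressions have equal length and swap roles: the one from `suc s`
-- now leads.
step₂-interleave′ : ∀ s n → step₂ s (suc n) ++ step₂ (suc s) n ↭ interval s (suc (n + n))
step₂-interleave′ s n =
  ↭-prep s (↭-trans (++-comm (step₂ (2 + s) n) _) (step₂-interleave (suc s) n))

map-proj₁-parallel : ∀ x y n → map proj₁ (parallel x y n) ≡ interval x n
map-proj₁-parallel x y zero    = refl
map-proj₁-parallel x y (suc n) = cong (x ∷_) (map-proj₁-parallel (suc x) (suc y) n)

map-proj₂-parallel : ∀ x y n → map proj₂ (parallel x y n) ≡ interval y n
map-proj₂-parallel x y zero    = refl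
map-proj₂-parallel x y (suc n) = cong (y ∷_) (map-proj₂-parallel (suc x) (suc y) n)

-- Both coordinates grow by 1 from pair to pair, hence the sums grow by 2.
map-sum-parallel : ∀ x y n → map (uncurry _+_) (parallel x y n) ≡ step₂ (x + y) n
map-sum-parallel x y zero    = refl
map-sum-parallel x y (suc n) = cong (x + y ∷_)
  (trans (map-sum-parallel (suc x) (suc y) n) (cong (λ z → step₂ (suc z) n) (+-suc x y)))

length-parallel : ∀ x y n → length (parallel x y n) ≡ n
length-parallel x y zero    = refl
length-parallel x y (suc n) = cong suc (length-parallel (suc x) (suc y) n)

tabulate-interval : ∀ s n → tabulate {n = n} (λ i → s + toℕ i) ≡ interval s n
tabulate-interval s zero    = refl
tabulate-interval s (suc n) = cong₂ _∷_ (+-identityʳ s)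
  (trans (tabulate-cong (λ i → +-suc s (toℕ i))) (tabulate-interval (suc s) n))

-- Pairing schemes and their construction.

-- The pairs are the labels of the two outer vertices of each triangle. The doubled labels,
-- the sums other than the one equal to m, and the unused residues together represent every
-- residue once.
record Scheme (m n : ℕ) : Set where
  field
    pairs                : List (ℕ × ℕ)
    doubled sums unused  : List ℕ
    start                : ℕ
    length-pairs         : length pairs ≡ n
    labels-↭             : 0 ∷ (map proj₁ pairs ++ map proj₂ pairs) ↭ interval 0 m ++ doubled
    sums-↭               : map (uncurry _+_) pairs ↭ m ∷ sums
    residues-↭           : doubled ++ (sums ++ unused) ↭ interval start m

-- The blocks [1 , u], [u + 1 , u + d], [u + d + 1 , 2u + d] of nonzero residues modulo m.
-- The sums i + (u + d + i) of the outer blocks progress in steps of 2; their gaps have room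
-- for e consecutive odd (or even) values with w further gaps on both sides.
module Blocks (u d e w : ℕ) (e+w+w : e + (w + w) ≡ suc u) where

  m s : ℕ
  m = suc (u + (d + u))
  s = suc (u + d)

  low mid high : List ℕ
  low  = interval 1 u
  mid  = interval (suc u) d
  high = interval s u

  interval-blocks : interval 1 (u + (d + u)) ≡ low ++ (mid ++ high)
  interval-blocks = trans (interval-++ 1 u refl) (cong (low ++_) (interval-++ (suc u) d refl))

  -- The values s, s + 2, ..., s + 2u are the gaps around the outer sums. By `e+w+w` they split into
  -- w, e and w terms, the e inner ones starting at `c`. Gaps and outer sums interleave to an
  -- interval that continues D.
  residues-blocks : ∀ c → s + (w + w) ≡ c →
    mid ++ ((step₂ s w ++ (step₂ c e ++ step₂ (c + (e + e)) w)) ++ step₂ (suc s) u) ↭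
    interval (suc u) m
  residues-blocks c eq = begin
    mid ++ ((step₂ s w ++ (step₂ c e ++ step₂ (c + (e + e)) w)) ++ step₂ (suc s) u)
      ≡⟨ cong (λ l → mid ++ (l ++ step₂ (suc s) u))
           (trans (step₂-++ s w eq) (cong (step₂ s w ++_) (step₂-++ c e refl))) ⟨
    mid ++ (step₂ s (w + (e + w)) ++ step₂ (suc s) u)
      ≡⟨ cong (λ n → mid ++ (step₂ s n ++ step₂ (suc s) u)) (trans (rearrange e w) e+w+w) ⟩
    mid ++ (step₂ s (suc u) ++ step₂ (suc s) u)
      ↭⟨ ++⁺ˡ mid (step₂-interleave′ s u) ⟩
    mid ++ interval s (suc (u + u))
      ≡⟨ interval-++ (suc u) d refl ⟨
    interval (suc u) (d + suc (u + u))
      ≡⟨ cong (interval (suc u)) (size u d) ⟩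
    interval (suc u) m ∎
    where
    open PermutationReasoning
    rearrange : ∀ e w → w + (e + w) ≡ e + (w + w)
    rearrange = solve-∀
    size : ∀ u d → d + suc (u + u) ≡ suc (u + (d + u))
    size = solve-∀

map-parallel-++ : ∀ {a b x y} p q (π : ℕ × ℕ → ℕ) {xs ys} →
  map π (parallel a b p) ≡ xs → map π (parallel x y q) ≡ ys →
  map π (parallel a b p ++ parallel x y q) ≡ xs ++ ys
map-parallel-++ {a} {b} p q π eq₁ eq₂ = trans (map-++ π (parallel a b p) _) (cong₂ _++_ eq₁ eq₂)

-- The pair (1 + h, s + h) is the middle one of the outer blocks, with sum m; `h` outer sums lie on
-- either side of it.
scheme-odd : ∀ u d h w → u ≡ h + suc h → d + (w + w) ≡ suc u →
             Scheme (suc (u + (d + u))) (u + d)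
scheme-odd u d h w u≡ d+w+w = record
  { pairs        = parallel 1 s u ++ parallel (suc u) (suc u) d
  ; doubled      = mid
  ; sums         = S₁ ++ (S₂ ++ M)
  -- The value `m` was taken out of the outer sums for the distinguished pair; it returns here to
  -- keep the residue system complete.
  ; unused       = m ∷ (W₁ ++ W₂)
  ; start        = suc u
  ; length-pairs = trans (length-++ (parallel 1 s u))
                         (cong₂ _+_ (length-parallel 1 s u) (length-parallel (suc u) (suc u) d))
  ; labels-↭     = ↭-prep 0 (begin
      map proj₁ ps ++ map proj₂ ps
        ≡⟨ cong₂ _++_ (map-parallel-++ u d proj₁ (map-proj₁-parallel 1 s u) (map-proj₁-parallel _ _ d))
                      (map-parallel-++ u d proj₂ (map-proj₂-parallel 1 s u) (map-proj₂-parallel _ _ d)) ⟩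
      (low ++ mid) ++ (high ++ mid)
        -- Up to permutation, lists under concatenation form a commutative monoid, so its solver can
        -- rearrange whole blocks.
        ↭⟨ solve 3 (λ l d h → (l ⊕ d) ⊕ (h ⊕ d) ⊜ (l ⊕ (d ⊕ h)) ⊕ d) (↭-reflexive refl) low mid high ⟩
      (low ++ (mid ++ high)) ++ mid
        ≡⟨ cong (_++ mid) interval-blocks ⟨
      interval 1 (u + (d + u)) ++ mid ∎)
  ; sums-↭       = begin
      map (uncurry _+_) ps
        ≡⟨ map-parallel-++ u d (uncurry _+_) (map-sum-parallel 1 s u) (map-sum-parallel _ _ d) ⟩
      step₂ (suc s) u ++ M
        ≡⟨ cong (_++ M) split ⟩
      (S₁ ++ (m ∷ S₂)) ++ M
        ↭⟨ solve 4 (λ a x b c → (a ⊕ (x ⊕ b)) ⊕ c ⊜ x ⊕ (a ⊕ (b ⊕ c))) (↭-reflexive refl) S₁ [ m ] S₂ M ⟩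
      m ∷ (S₁ ++ (S₂ ++ M)) ∎
  ; residues-↭   = begin
      mid ++ ((S₁ ++ (S₂ ++ M)) ++ ([ m ] ++ (W₁ ++ W₂)))
        ↭⟨ ++⁺ˡ mid (solve 6 (λ a b c x v w →
             (a ⊕ (b ⊕ c)) ⊕ (x ⊕ (v ⊕ w)) ⊜ (v ⊕ (c ⊕ w)) ⊕ (a ⊕ (x ⊕ b)))
             (↭-reflexive refl) S₁ S₂ M [ m ] W₁ W₂) ⟩
      mid ++ ((W₁ ++ (M ++ W₂)) ++ (S₁ ++ (m ∷ S₂)))
        ≡⟨ cong (λ l → mid ++ ((W₁ ++ (M ++ W₂)) ++ l)) split ⟨
      mid ++ ((W₁ ++ (M ++ W₂)) ++ step₂ (suc s) u)
        -- The least sum x + x over D is 2(u + 1). By d + 2w = u + 1 it equals s + 2w, the gap after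
        -- the first w.
        ↭⟨ residues-blocks (suc u + suc u) (trans (shuffle u d w) (cong (suc u +_) d+w+w)) ⟩
      interval (suc u) m ∎
  }
  where
  open PermutationReasoning
  open Blocks u d d w d+w+w
  ps = parallel 1 s u ++ parallel (suc u) (suc u) d
  S₁ = step₂ (suc s) h
  S₂ = step₂ (2 + m) h
  M  = step₂ (suc u + suc u) d
  W₁ = step₂ s w
  W₂ = step₂ (suc u + suc u + (d + d)) w
  shuffle : ∀ u d w → suc (u + d) + (w + w) ≡ suc u + (d + (w + w))
  shuffle = solve-∀
  middle : ∀ u d h → u ≡ h + suc h → suc (suc (u + d)) + (h + h) ≡ suc (u + (d + u))
  middle _ d h refl = lemma d h
    where
    lemma : ∀ d h → suc (suc (h + suc h + d)) + (h + h) ≡ suc (h + suc h + (d + (h + suc h)))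
    lemma = solve-∀
  split : step₂ (suc s) u ≡ S₁ ++ (m ∷ S₂)
  split = trans (cong (step₂ (suc s)) u≡) (step₂-++ (suc s) h (middle u d h u≡))

-- Here d is `suc e`. With one copy of D losing its last element and the other its first, `e` pairs
-- (x, x + 1) remain; the two lost ends sum to (u + 1) + (u + 1 + e) = m.
scheme-even : ∀ u e w → e + (w + w) ≡ suc u → Scheme (suc (u + (suc e + u))) (u + suc e)
scheme-even u e w e+w+w = record
  { pairs        = ps
  ; doubled      = mid
  ; sums         = S ++ M
  ; unused       = W₁ ++ W₂
  ; start        = suc u
  ; length-pairs = trans
      (cong suc (trans (length-++ (parallel 1 s u))
                       (cong₂ _+_ (length-parallel 1 s u) (length-parallel (suc u) (2 + u) e))))
      (sym (+-suc u e))
  ; labels-↭     = ↭-prep 0 (begin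
      map proj₁ ps ++ map proj₂ ps
        ≡⟨ cong₂ (λ xs ys → suc u ∷ (xs ++ (suc u + e ∷ ys)))
             (map-parallel-++ u e proj₁ (map-proj₁-parallel 1 s u) (map-proj₁-parallel _ _ e))
             (map-parallel-++ u e proj₂ (map-proj₂-parallel 1 s u) (map-proj₂-parallel _ _ e)) ⟩
      [ suc u ] ++ ((low ++ init) ++ ([ suc u + e ] ++ (high ++ tail)))
        -- The copies of D are reassembled: `i ⊕ z` is the one split at its last element, `f ⊕ t`
        -- the one split at its first.
        ↭⟨ solve 6 (λ f l i z h t →
             f ⊕ ((l ⊕ i) ⊕ (z ⊕ (h ⊕ t))) ⊜ (l ⊕ ((i ⊕ z) ⊕ h)) ⊕ (f ⊕ t))
             (↭-reflexive refl) [ suc u ] low init [ suc u + e ] high tail ⟩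
      (low ++ ((init ++ [ suc u + e ]) ++ high)) ++ mid
        ≡⟨ cong (λ l → (low ++ (l ++ high)) ++ mid) mid≡ ⟨
      (low ++ (mid ++ high)) ++ mid
        ≡⟨ cong (_++ mid) interval-blocks ⟨
      interval 1 (u + (suc e + u)) ++ mid ∎)
  ; sums-↭       = ↭-reflexive (cong₂ _∷_ (outermost u e)
      (map-parallel-++ u e (uncurry _+_) (map-sum-parallel 1 s u) (map-sum-parallel _ _ e)))
  ; residues-↭   = begin
      mid ++ ((S ++ M) ++ (W₁ ++ W₂))
        ↭⟨ ++⁺ˡ mid (solve 4 (λ a c v w → (a ⊕ c) ⊕ (v ⊕ w) ⊜ (v ⊕ (c ⊕ w)) ⊕ a)
             (↭-reflexive refl) S M W₁ W₂) ⟩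
      mid ++ ((W₁ ++ (M ++ W₂)) ++ S)
        -- The least sum x + (x + 1) is 2u + 3, again s + 2w because s is now u + e + 2.
        ↭⟨ residues-blocks (suc u + (2 + u))
             (trans (shuffle u e w) (trans (cong (2 + u +_) e+w+w) (cong suc (sym (+-suc u (suc u)))))) ⟩
      interval (suc u) m ∎
  }
  where
  open PermutationReasoning
  open Blocks u (suc e) e w e+w+w
  ps = (suc u , suc u + e) ∷ (parallel 1 s u ++ parallel (suc u) (2 + u) e)
  init tail : List ℕ
  init = interval (suc u) e
  tail = interval (2 + u) e
  S  = step₂ (suc s) u
  M  = step₂ (suc u + (2 + u)) e
  W₁ = step₂ s w
  W₂ = step₂ (suc u + (2 + u) + (e + e)) w
  mid≡ : mid ≡ init ++ [ suc u + e ]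
  mid≡ = trans (cong (interval (suc u)) (+-comm 1 e)) (interval-++ (suc u) e refl)
  outermost : ∀ u e → suc u + (suc u + e) ≡ suc (u + (suc e + u))
  outermost = solve-∀
  shuffle : ∀ u e w → suc (u + suc e) + (w + w) ≡ 2 + u + (e + (w + w))
  shuffle = solve-∀

-- With nothing doubled and u even no parallel pair sums to m, so 1 is paired with 2k first.
scheme-undoubled : ∀ n → Scheme (suc (suc n + suc n)) (suc n)
scheme-undoubled n = record
  { pairs        = ps
  ; doubled      = []
  ; sums         = step₂ (4 + n) n
  -- The values that interleave with the sums, followed by three more to reach m = 2n + 3
  -- consecutive residues.
  ; unused       = step₂ (5 + n) n ++ interval (4 + n + (n + n)) 3
  ; start        = 4 + n
  ; length-pairs = cong suc (length-parallel 2 (2 + n) n)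
  ; labels-↭     = ↭-prep 0 (↭-prep 1 (begin
      map proj₁ (parallel 2 (2 + n) n) ++ (suc n + suc n ∷ map proj₂ (parallel 2 (2 + n) n))
        ≡⟨ cong₂ (λ xs ys → xs ++ (suc n + suc n ∷ ys))
             (map-proj₁-parallel 2 (2 + n) n) (map-proj₂-parallel 2 (2 + n) n) ⟩
      interval 2 n ++ ([ suc n + suc n ] ++ interval (2 + n) n)
        ↭⟨ ++⁺ˡ (interval 2 n) (++-comm [ suc n + suc n ] (interval (2 + n) n)) ⟩
      interval 2 n ++ (interval (2 + n) n ++ [ suc n + suc n ])
        ≡⟨ cong (interval 2 n ++_) (interval-++ (2 + n) n (cong suc (sym (+-suc n n)))) ⟨
      interval 2 n ++ interval (2 + n) (n + 1)
        ≡⟨ interval-++ 2 n refl ⟨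
      interval 2 (n + (n + 1))
        ≡⟨ cong (interval 2) (cong (n +_) (+-comm n 1)) ⟩
      interval 2 (n + suc n)
        ≡⟨ ++-identityʳ _ ⟨
      interval 2 (n + suc n) ++ [] ∎))
  ; sums-↭       = ↭-prep (suc (suc n + suc n)) (↭-reflexive (map-sum-parallel 2 (2 + n) n))
  ; residues-↭   = begin
      step₂ (4 + n) n ++ (step₂ (5 + n) n ++ interval (4 + n + (n + n)) 3)
        ≡⟨ ++-assoc (step₂ (4 + n) n) _ _ ⟨
      (step₂ (4 + n) n ++ step₂ (5 + n) n) ++ interval (4 + n + (n + n)) 3
        ↭⟨ ++⁺ʳ _ (step₂-interleave (4 + n) n) ⟩
      interval (4 + n) (n + n) ++ interval (4 + n + (n + n)) 3
        ≡⟨ interval-++ (4 + n) (n + n) refl ⟨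
      interval (4 + n) (n + n + 3)
        ≡⟨ cong (interval (4 + n)) (size n) ⟩
      interval (4 + n) (suc (suc n + suc n)) ∎
  }
  where
  open PermutationReasoning
  ps = (1 , suc n + suc n) ∷ parallel 2 (2 + n) n
  size : ∀ n → n + n + 3 ≡ suc (suc n + suc n)
  size = solve-∀

-- From a scheme to a cordial labeling.

∣n-n∣≤1 : ∀ n → ∣ n - n ∣ ≤ 1
∣n-n∣≤1 n = ≤-trans (≤-reflexive (∣n-n∣≡0 n)) z≤n

-- Every vertex and edge count will have the form 1 + x with x at most 1.
∣1+-1+∣≤1 : ∀ {x y} → x ≤ 1 → y ≤ 1 → ∣ 1 + x - 1 + y ∣ ≤ 1
∣1+-1+∣≤1 {x} {y} x≤1 y≤1 = ≤-trans (∣m-n∣≤m⊔n x y) (⊔-lub x≤1 y≤1)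

module _ (m : ℕ) .{{_ : NonZero m}} where

  open AbelianGroup (ℤ/ m) using (_∙_; identityˡ)

  toℕ-mod : ∀ x → toℕ (x mod m) ≡ x % m
  toℕ-mod x = Fin.toℕ-fromℕ< (m%n<n x m)

  mod-cong : ∀ {x y} → x % m ≡ y % m → x mod m ≡ y mod m
  mod-cong {x} {y} eq = Fin.toℕ-injective (trans (toℕ-mod x) (trans eq (sym (toℕ-mod y))))

  -- Allows the label of a rim edge to be computed as a sum of natural numbers and reduced once.
  mod-+ : ∀ x y → (x mod m) ∙ (y mod m) ≡ (x + y) mod m
  mod-+ x y = mod-cong (trans (cong₂ (λ u v → (u + v) % m) (toℕ-mod x) (toℕ-mod y))
                              (sym (%-distribˡ-+ x y m)))

  toℕ-mod-id : ∀ (i : Fin m) → toℕ i mod m ≡ i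
  toℕ-mod-id i = Fin.toℕ-injective (trans (toℕ-mod (toℕ i)) (m<n⇒m%n≡m (Fin.toℕ<n i)))

  occ-residue : Fin m → List ℕ → ℕ
  occ-residue = occ (_mod m)

  -- The reduction is first moved into the list with `occ-map`; there the congruence of s + m and s
  -- becomes an equality of entries.
  occ-[m+] : ∀ a s → occ-residue a [ s + m ] ≡ occ-residue a [ s ]
  occ-[m+] a s = trans (sym (occ-map id (_mod m) a [ s + m ]))
    (trans (cong (λ r → occ id a [ r ]) (mod-cong ([m+n]%n≡m%n s m)))
           (occ-map id (_mod m) a [ s ]))

  occ-interval : ∀ a s → occ-residue a (interval s m) ≡ 1
  occ-interval a zero    = begin
    occ-residue a (interval 0 m)         ≡⟨ cong (occ-residue a) (tabulate-interval 0 m) ⟨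
    occ-residue a (tabulate toℕ)         ≡⟨ cong (occ-residue a) (map-tabulate id toℕ) ⟨
    occ-residue a (map toℕ (allFin m))   ≡⟨ occ-map (_mod m) toℕ a (allFin m) ⟩
    occ (λ i → toℕ i mod m) a (allFin m) ≡⟨ occ-cong a toℕ-mod-id (allFin m) ⟩
    occ id a (allFin m)                  ≡⟨ occ-allFin a ⟩
    1                                    ∎
    where open ≡-Reasoning
  -- The numbers from s to s + m are split off at either end. The two ends are congruent, so their
  -- counts cancel.
  occ-interval a (suc s) = +-cancelˡ-≡ (occ-residue a [ s ]) _ _ (begin
    occ-residue a [ s ] + occ-residue a (interval (suc s) m)
      ≡⟨ occ-++ (_mod m) a [ s ] (interval (suc s) m) ⟨
    occ-residue a (interval s (1 + m))
      ≡⟨ cong (occ-residue a ∘ interval s) (+-comm 1 m) ⟩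
    occ-residue a (interval s (m + 1))
      ≡⟨ cong (occ-residue a) (interval-++ s m refl) ⟩
    occ-residue a (interval s m ++ [ s + m ])
      ≡⟨ occ-++ (_mod m) a (interval s m) [ s + m ] ⟩
    occ-residue a (interval s m) + occ-residue a [ s + m ]
      ≡⟨ cong₂ _+_ (occ-interval a s) (occ-[m+] a s) ⟩
    1 + occ-residue a [ s ]
      ≡⟨ +-comm 1 _ ⟩
    occ-residue a [ s ] + 1  ∎)
    where open ≡-Reasoning

  module _ (ps : List (ℕ × ℕ)) where

    private
      n : ℕ
      n = length ps
    open Friendship n

    component : Fin n × Fin 2 → ℕ
    component (i , zero)     = proj₁ (lookup ps i)
    component (i , suc zero) = proj₂ (lookup ps i)

    label : Fin (suc (n * 2)) → Fin m
    label zero    = 0 mod m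
    label (suc x) = component (remQuot 2 x) mod m

    label-leaf : ∀ i b → label (suc (combine i b)) ≡ component (i , b) mod m
    label-leaf i b = cong (λ p → component p mod m) (Fin.remQuot-combine i b)

    occ-outer : ∀ a → occ (label ∘ suc) a (allFin (n * 2)) ≡
                      occ-residue a (map proj₁ ps ++ map proj₂ ps)
    occ-outer a = begin
      occ (label ∘ suc) a (allFin (n * 2))
        ≡⟨ occ-↭ (label ∘ suc) a leaves-↭ ⟩
      occ (label ∘ suc) a (map leaf₀ (allFin n) ++ map leaf₁ (allFin n))
        ≡⟨ occ-++ (label ∘ suc) a (map leaf₀ (allFin n)) _ ⟩
      occ (label ∘ suc) a (map leaf₀ (allFin n)) + occ (label ∘ suc) a (map leaf₁ (allFin n))
        ≡⟨ cong₂ _+_ (leaves leaf₀ proj₁ (λ i → label-leaf i zero))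
                     (leaves leaf₁ proj₂ (λ i → label-leaf i (suc zero))) ⟩
      occ-residue a (map proj₁ ps) + occ-residue a (map proj₂ ps)
        ≡⟨ occ-++ (_mod m) a (map proj₁ ps) _ ⟨
      occ-residue a (map proj₁ ps ++ map proj₂ ps) ∎
      where
      open ≡-Reasoning
      leaves : ∀ (leaf : Fin n → Fin (n * 2)) (π : ℕ × ℕ → ℕ) →
               (∀ i → label (suc (leaf i)) ≡ π (lookup ps i) mod m) →
               occ (label ∘ suc) a (map leaf (allFin n)) ≡ occ-residue a (map π ps)
      leaves leaf π eq = begin
        occ (label ∘ suc) a (map leaf (allFin n))        ≡⟨ occ-map (label ∘ suc) leaf a _ ⟩
        occ (label ∘ suc ∘ leaf) a (allFin n)            ≡⟨ occ-cong a eq (allFin n) ⟩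
        occ ((_mod m) ∘ π ∘ lookup ps) a (allFin n)      ≡⟨ occ-lookup ((_mod m) ∘ π) a ps ⟩
        occ ((_mod m) ∘ π) a ps                          ≡⟨ occ-map (_mod m) π a ps ⟨
        occ-residue a (map π ps)                         ∎

    f-V-label : ∀ a → f-V (ℤ/ m) _≟_ (F n) label a ≡
                      occ-residue a (0 ∷ (map proj₁ ps ++ map proj₂ ps))
    f-V-label a = begin
      f-V (ℤ/ m) _≟_ (F n) label a
        ≡⟨ occ-filter label a (allFin (suc (n * 2))) ⟩
      occ label a (allFin (suc (n * 2)))
        ≡⟨ cong (λ xs → occ label a (zero ∷ xs)) (map-tabulate id suc) ⟨
      occ label a (zero ∷ map suc (allFin (n * 2)))
        ≡⟨ occ-++ label a [ zero ] _ ⟩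
      occ label a [ zero ] + occ label a (map suc (allFin (n * 2)))
        -- Both counts of the centre agree with the count in the one-element list of the residue 0.
        ≡⟨ cong₂ _+_ (sym (trans (sym (occ-map id (_mod m) a [ 0 ])) (occ-map id label a [ zero ])))
                     (trans (occ-map label suc a _) (occ-outer a)) ⟩
      occ-residue a [ 0 ] + occ-residue a (map proj₁ ps ++ map proj₂ ps)
        ≡⟨ occ-++ (_mod m) a [ 0 ] _ ⟨
      occ-residue a (0 ∷ (map proj₁ ps ++ map proj₂ ps)) ∎
      where open ≡-Reasoning

    -- The centre has label 0, so a spoke carries the label of its outer end; a rim edge carries the
    -- sum of its pair.
    f-E-label : ∀ a → f-E (ℤ/ m) _≟_ (F n) label a ≡
                      occ-residue a (map proj₁ ps ++ map proj₂ ps) + occ-residue a (map (uncurry _+_) ps)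
    f-E-label a = begin
      f-E (ℤ/ m) _≟_ (F n) label a
        ≡⟨ occ-filter edge a (Graph.edges (F n)) ⟩
      occ edge a (Graph.edges (F n))
        ≡⟨ occ-↭ edge a edges-↭ ⟩
      occ edge a (map spoke (allFin (n * 2)) ++ map rim (allFin n))
        ≡⟨ occ-++ edge a (map spoke (allFin (n * 2))) _ ⟩
      occ edge a (map spoke (allFin (n * 2))) + occ edge a (map rim (allFin n))
        ≡⟨ cong₂ _+_ (occ-map edge spoke a _) (occ-map edge rim a _) ⟩
      occ (edge ∘ spoke) a (allFin (n * 2)) + occ (edge ∘ rim) a (allFin n)
        ≡⟨ cong₂ _+_ (occ-cong a (λ x → identityˡ (label (suc x))) _) (occ-cong a rim-label _) ⟩
      occ (label ∘ suc) a (allFin (n * 2)) + occ ((_mod m) ∘ uncurry _+_ ∘ lookup ps) a (allFin n)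
        ≡⟨ cong₂ _+_ (occ-outer a) (occ-lookup ((_mod m) ∘ uncurry _+_) a ps) ⟩
      occ-residue a (map proj₁ ps ++ map proj₂ ps) + occ ((_mod m) ∘ uncurry _+_) a ps
        ≡⟨ cong (occ-residue a (map proj₁ ps ++ map proj₂ ps) +_) (occ-map (_mod m) (uncurry _+_) a ps) ⟨
      occ-residue a (map proj₁ ps ++ map proj₂ ps) + occ-residue a (map (uncurry _+_) ps) ∎
      where
      open ≡-Reasoning
      edge : Fin (suc (n * 2)) × Fin (suc (n * 2)) → Fin m
      edge = edgeLabel (ℤ/ m) _≟_ (F n) label
      rim-label : ∀ i → edge (rim i) ≡ uncurry _+_ (lookup ps i) mod m
      rim-label i = trans (cong₂ _∙_ (label-leaf i zero) (label-leaf i (suc zero)))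
                          (mod-+ (proj₁ (lookup ps i)) (proj₂ (lookup ps i)))

  -- A vertex label a occurs 1 + `# a D` times and an edge label 1 + `# a D` + `# a T` times; both
  -- excesses are at most 1.
  scheme⇒cordial : ∀ {n} → Scheme m n → Cordial (ℤ/ m) _≟_ (F n)
  scheme⇒cordial record { pairs = ps ; doubled = D ; sums = T ; unused = W ; start = s
                        ; length-pairs = refl ; labels-↭ = labels-↭
                        ; sums-↭ = sums-↭ ; residues-↭ = residues-↭ } =
    label ps , λ a₁ a₂ →
      subst₂ (λ x y → ∣ x - y ∣ ≤ 1) (sym (f-V≡ a₁)) (sym (f-V≡ a₂)) (∣1+-1+∣≤1 (D≤1 a₁) (D≤1 a₂)) ,
      subst₂ (λ x y → ∣ x - y ∣ ≤ 1) (sym (f-E≡ a₁)) (sym (f-E≡ a₂)) (∣1+-1+∣≤1 (D+T≤1 a₁) (D+T≤1 a₂))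
    where
    # : Fin m → List ℕ → ℕ
    # = occ-residue
    outer = map proj₁ ps ++ map proj₂ ps
    #outer : ∀ a → # a (0 ∷ outer) ≡ 1 + # a D
    #outer a = trans (occ-↭ (_mod m) a labels-↭)
      (trans (occ-++ (_mod m) a (interval 0 m) D) (cong (_+ # a D) (occ-interval a 0)))
    -- The lists `D`, `T` and `W` together form a complete residue system, in which a is hit once.
    D+T≤1 : ∀ a → # a D + # a T ≤ 1
    D+T≤1 a = begin
      # a D + # a T            ≤⟨ +-monoʳ-≤ (# a D) (m≤m+n (# a T) (# a W)) ⟩
      # a D + (# a T + # a W)  ≡⟨ cong (# a D +_) (occ-++ (_mod m) a T W) ⟨
      # a D + # a (T ++ W)     ≡⟨ occ-++ (_mod m) a D (T ++ W) ⟨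
      # a (D ++ (T ++ W))      ≡⟨ occ-↭ (_mod m) a residues-↭ ⟩
      # a (interval s m)       ≡⟨ occ-interval a s ⟩
      1                        ∎
      where open ≤-Reasoning
    D≤1 : ∀ a → # a D ≤ 1
    D≤1 a = ≤-trans (m≤m+n (# a D) (# a T)) (D+T≤1 a)
    f-V≡ : ∀ a → f-V (ℤ/ m) _≟_ (F (length ps)) (label ps) a ≡ 1 + # a D
    f-V≡ a = trans (f-V-label ps a) (#outer a)
    -- The sum m is congruent to 0 and takes the place of the centre's label, so that with the
    -- spokes it yields the vertex count 1 + `# a D`.
    f-E≡ : ∀ a → f-E (ℤ/ m) _≟_ (F (length ps)) (label ps) a ≡ 1 + (# a D + # a T)
    f-E≡ a = begin
      f-E (ℤ/ m) _≟_ (F (length ps)) (label ps) a  ≡⟨ f-E-label ps a ⟩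
      # a outer + # a (map (uncurry _+_) ps)       ≡⟨ cong (# a outer +_) (occ-↭ (_mod m) a sums-↭) ⟩
      # a outer + # a (m ∷ T)                      ≡⟨ cong (# a outer +_) (occ-++ (_mod m) a [ m ] T) ⟩
      # a outer + (# a [ m ] + # a T)              ≡⟨ +-assoc (# a outer) _ _ ⟨
      # a outer + # a [ m ] + # a T                ≡⟨ cong (_+ # a T) (+-comm (# a outer) _) ⟩
      # a [ m ] + # a outer + # a T                ≡⟨ cong (λ x → x + # a outer + # a T) (occ-[m+] a 0) ⟩
      # a [ 0 ] + # a outer + # a T                ≡⟨ cong (_+ # a T) (occ-++ (_mod m) a [ 0 ] outer) ⟨
      # a (0 ∷ outer) + # a T                      ≡⟨ cong (_+ # a T) (#outer a) ⟩
      1 + (# a D + # a T)                          ∎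
      where open ≡-Reasoning

-- Choice of the block sizes.

even⊎odd : ∀ u → ∃[ h ] (u ≡ h + h ⊎ u ≡ h + suc h)
even⊎odd zero    = 0 , inj₁ refl
even⊎odd (suc u) with even⊎odd u
... | h , inj₁ refl = h , inj₂ (sym (+-suc h h))
... | h , inj₂ refl = suc h , inj₁ refl

-- With t = `suc t′` and k = u + t, the middle block has size d = 2t, so j = u + d is k + t. The
-- bound on 2t says exactly that the number `h ∸ t′` of gaps on each side is not truncated.
scheme-doubled : ∀ u t′ → 2 * suc t′ ≤ u + 2 →
                 Scheme (2 * (u + suc t′) + 1) (u + suc t′ + suc t′)
scheme-doubled u t′ 2t≤u+2 with even⊎odd u
... | h , inj₁ refl = subst₂ Scheme (order h t′) (size h t′)
                        (scheme-even (h + h) (t′ + suc t′) (h ∸ t′) gaps)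
  where
  order : ∀ h t′ → suc (h + h + (suc (t′ + suc t′) + (h + h))) ≡ 2 * (h + h + suc t′) + 1
  order = solve-∀
  size : ∀ h t′ → h + h + suc (t′ + suc t′) ≡ h + h + suc t′ + suc t′
  size = solve-∀
  double : ∀ h → h + h + 2 ≡ 2 * suc h
  double = solve-∀
  t′≤h : t′ ≤ h
  t′≤h = ≤-pred (*-cancelˡ-≤ 2 (≤-trans 2t≤u+2 (≤-reflexive (double h))))
  regroup : ∀ t′ w → t′ + suc t′ + (w + w) ≡ suc (t′ + w + (t′ + w))
  regroup = solve-∀
  gaps : t′ + suc t′ + (h ∸ t′ + (h ∸ t′)) ≡ suc (h + h)
  gaps = trans (regroup t′ (h ∸ t′)) (cong (λ x → suc (x + x)) (m+[n∸m]≡n t′≤h))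
... | h , inj₂ refl = subst₂ Scheme (order h t′) (sym (+-assoc (h + suc h) (suc t′) (suc t′)))
                        (scheme-odd (h + suc h) (suc t′ + suc t′) h (h ∸ t′) refl gaps)
  where
  order : ∀ h t′ → suc (h + suc h + (suc t′ + suc t′ + (h + suc h))) ≡ 2 * (h + suc h + suc t′) + 1
  order = solve-∀
  double : ∀ h → suc (h + suc h + 2) ≡ 2 * suc (suc h)
  double = solve-∀
  -- Here u + 2 = 2h + 3 is odd; the bound is weakened to the strict 2t < 2(h + 2) before halving.
  t′≤h : t′ ≤ h
  t′≤h = ≤-pred (≤-pred (*-cancelˡ-< 2 (suc t′) (2 + h)
    (≤-trans (s≤s 2t≤u+2) (≤-reflexive (double h)))))
  regroup : ∀ t′ w → suc t′ + suc t′ + (w + w) ≡ suc (t′ + w + suc (t′ + w))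
  regroup = solve-∀
  gaps : suc t′ + suc t′ + (h ∸ t′ + (h ∸ t′)) ≡ suc (h + suc h)
  gaps = trans (regroup t′ (h ∸ t′)) (cong (λ x → suc (x + suc x)) (m+[n∸m]≡n t′≤h))

scheme : ∀ k j → 0 < k → k ≤ j → j * 3 ≤ 2 * (2 * k + 1) → Scheme (2 * k + 1) j
scheme k j 0<k k≤j 3j≤2m with m≤n⇒∃[o]m+o≡n k≤j
scheme (suc n) _ _ _ _ | zero , refl =
  subst₂ Scheme (order n) (sym (+-identityʳ (suc n))) (scheme-undoubled n)
  where
  order : ∀ n → suc (suc n + suc n) ≡ 2 * suc n + 1
  order = solve-∀
scheme k _ _ _ 3j≤2m | suc t′ , refl with m≤n⇒∃[o]m+o≡n t≤k
  where
  lhs : ∀ k t → (k + t) * 3 ≡ 3 * k + 2 * t + t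
  lhs = solve-∀
  rhs : ∀ k → 2 * (2 * k + 1) ≡ 3 * k + 2 + k
  rhs = solve-∀
  -- With t = `suc t′`, the bound on j gives 3t ≤ k + 2, and 2 ≤ 2t leaves t ≤ k. Hence k = t + u
  -- for some u.
  t≤k : suc t′ ≤ k
  t≤k = +-cancelˡ-≤ (3 * k + 2) (suc t′) k (begin
    3 * k + 2 + suc t′             ≤⟨ +-monoˡ-≤ (suc t′) (+-monoʳ-≤ (3 * k) (*-monoʳ-≤ 2 (s≤s z≤n))) ⟩
    3 * k + 2 * suc t′ + suc t′    ≡⟨ lhs k (suc t′) ⟨
    (k + suc t′) * 3               ≤⟨ 3j≤2m ⟩
    2 * (2 * k + 1)                ≡⟨ rhs k ⟩
    3 * k + 2 + k                  ∎)
    where open ≤-Reasoning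
... | u , refl = subst (λ k → Scheme (2 * k + 1) (k + suc t′)) (+-comm u (suc t′))
                   (scheme-doubled u t′ 2t≤u+2)
  where
  lhs : ∀ u t → (t + u + t) * 3 ≡ 3 * u + 4 * t + 2 * t
  lhs = solve-∀
  rhs : ∀ u t → 2 * (2 * (t + u) + 1) ≡ 3 * u + 4 * t + (u + 2)
  rhs = solve-∀
  -- Written in u and t, the bound is 3u + 6t ≤ 4u + 4t + 2; the common part 3u + 4t cancels.
  2t≤u+2 : 2 * suc t′ ≤ u + 2
  2t≤u+2 = +-cancelˡ-≤ (3 * u + 4 * suc t′) _ _
    (subst₂ _≤_ (lhs u (suc t′)) (rhs u (suc t′)) 3j≤2m)

theorem11p2 : (m : ℕ) .{{_ : NonZero m}} (k : ℕ) → m ≡ 2 * k + 1 → (j : ℕ) → m / 2 ≤ j → j ≤ (2 * m) / 3 ∸ ε k → Cordial (ℤ/ m) _≟_ (F j)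
-- For k = 0 the group is trivial: every count is compared with itself, and the constant labeling
-- works.
theorem11p2 _ zero refl j _ _ = (λ _ → zero) , λ where
  zero zero → ∣n-n∣≤1 (f-V (ℤ/ 1) _≟_ (F j) (λ _ → zero) zero)
            , ∣n-n∣≤1 (f-E (ℤ/ 1) _≟_ (F j) (λ _ → zero) zero)
theorem11p2 _ k@(suc _) refl j m/2≤j j≤ = scheme⇒cordial (2 * k + 1)
  (scheme k j (s≤s z≤n) (≤-trans k≤m/2 m/2≤j) 3j≤2m)
  where
  open ≤-Reasoning
  k≤m/2 : k ≤ (2 * k + 1) / 2
  k≤m/2 = begin
    k                ≡⟨ m*n/n≡m k 2 ⟨
    k * 2 / 2        ≡⟨ cong (_/ 2) (*-comm k 2) ⟩
    2 * k / 2        ≤⟨ /-monoˡ-≤ 2 (m≤m+n (2 * k) 1) ⟩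
    (2 * k + 1) / 2  ∎
  3j≤2m : j * 3 ≤ 2 * (2 * k + 1)
  3j≤2m = begin
    j * 3                          ≤⟨ *-monoˡ-≤ 3 (≤-trans j≤ (m∸n≤m _ (ε k))) ⟩
    2 * (2 * k + 1) / 3 * 3        ≤⟨ m/n*n≤m (2 * (2 * k + 1)) 3 ⟩
    2 * (2 * k + 1)                ∎
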